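{- Let $(A,\mathrm{Pr})$ be a finitary probability space, let $n\in\mathbb{N}$, let $t$ and $u$ be Boolean terms in $T[x_1,\dots,x_n]$, and let $a_1,\dots,a_{2n}\in A$ be events such that the events $a_1,\dots,a_n$ are independent of the events $a_{n+1},\dots,a_{2n}$. Then the two events $$a:=\Phi_A[t;\,a_1,\dots,a_n]\quad\text{and}\quad b:=\Phi_A[u;\,a_{n+1},\dots,a_{2n}]$$ are independent, that is, $\mathrm{Pr}(a\wedge b)=\mathrm{Pr}(a)\,\mathrm{Pr}(b)$.
   Context: $\mathbb{N}=\{1,2,\dots\}$. A finitary probability space is a pair $(A,\mathrm{Pr})$ of a Boolean algebra $A=(A,\vee,\wedge,{}^c,0_A,1_A)$ (with $0_A\ne1_A$) and a map $\mathrm{Pr}\colon A\to[0,1]$ such that $\mathrm{Pr}(0_A)=0$, $\mathrm{Pr}(1_A)=1$ and $\mathrm{Pr}(a\vee b)=\mathrm{Pr}(a)+\mathrm{Pr}(b)-\mathrm{Pr}(a\wedge b)$ for all $a,b\in A$. Elements of $A$ are called events. Independence of tuples: finite tuples of events $a_i$, $i\in I$, and $b_i$, $i\in J$: the former are independent of the latter if for all subsets $X\subset I$ and $Y\subset J$ one has $\mathrm{Pr}\big(\bigwedge_{i\in X}a_i\wedge\bigwedge_{i\in Y}b_i\big)=\mathrm{Pr}\big(\bigwedge_{i\in X}a_i\big)\mathrm{Pr}\big(\bigwedge_{i\in Y}b_i\big)$, where an empty meet is $1_A$. Boolean terms: words built from variables $x_1,x_2,\dots$, symbols $\vee,\wedge,\neg,0,1$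 and brackets by the rules: $0$, $1$ and each variable are terms; if $t,u$ are terms then $\neg(t)$, $(t\vee u)$, $(t\wedge u)$ are terms. $T[x_1,\dots,x_n]$ is the set of terms using only variables among $x_1,\dots,x_n$. Evaluation: for $t\in T[x_1,\dots,x_n]$ and $\overline{b}=(b_1,\dots,b_n)\in A^n$, $\Phi_A[t;\overline{b}]\in A$ is defined recursively by $\Phi_A[0;\overline{b}]=0_A$, $\Phi_A[1;\overline{b}]=1_A$, $\Phi_A[x_i;\overline{b}]=b_i$, $\Phi_A[\neg(t);\overline{b}]=\Phi_A[t;\overline{b}]^c$, $\Phi_A[(t\vee u);\overline{b}]=\Phi_A[t;\overline{b}]\vee\Phi_A[u;\overline{b}]$, $\Phi_A[(t\wedge u);\overline{b}]=\Phi_A[t;\overline{b}]\wedge\Phi_A[u;\overline{b}]$. -}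

module Defs where

open import Algebra.Lattice.Bundles using (BooleanAlgebra)
open import Data.Fin.Base using (Fin)
open import Data.Fin.Subset using (Subset; inside; outside)
open import Data.Nat.Base as ℕ using (ℕ)
import Data.Nat.Properties as ℕ
open import Data.Product using (∃; _×_; _,_)
open import Data.Rational hiding (_⊔_)
open import Data.Rational.Properties
open import Data.Rational.Solver using (module +-*-Solver)
open import Data.Vec.Base using ([]; _∷_)
open import Data.Vec.Functional using (Vector; head; tail)
open import Level using (Level; suc; _⊔_)
open import Relation.Binary.PropositionalEquality
  using (_≡_; refl; sym; cong; cong₂; subst)
open import Relation.Nullary using (¬_)

------------------------------------------------------------------------
-- Real numbers, as Cauchy sequences of rationals.  Operations are
-- pointwise; _≈ℝ_ plays the role of equality of reals, so functions
-- into ℝ are compared with it rather than with _≡_.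

IsCauchy : (ℕ → ℚ) → Set
IsCauchy x = ∀ ε → 0ℚ < ε →
  ∃ λ N → ∀ m n → N ℕ.≤ m → N ℕ.≤ n → ∣ x m - x n ∣ < ε

record ℝ : Set where
  constructor mkℝ
  field
    seq    : ℕ → ℚ
    cauchy : IsCauchy seq

open ℝ public

infix 4 _≈ℝ_ _≤ℝ_

_≈ℝ_ : ℝ → ℝ → Set
x ≈ℝ y = ∀ ε → 0ℚ < ε →
  ∃ λ N → ∀ n → N ℕ.≤ n → ∣ seq x n - seq y n ∣ < ε

_≤ℝ_ : ℝ → ℝ → Set
x ≤ℝ y = ∀ ε → 0ℚ < ε →
  ∃ λ N → ∀ n → N ℕ.≤ n → seq x n ≤ seq y n + ε

fromℚ : ℚ → ℝ
fromℚ q = mkℝ (λ _ → q) λ ε 0<ε →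
  0 , λ _ _ _ _ → subst (λ r → ∣ r ∣ < ε) (sym (+-inverseʳ q)) 0<ε

0ℝ 1ℝ : ℝ
0ℝ = fromℚ 0ℚ
1ℝ = fromℚ 1ℚ

split : ∀ {ε B} → 0ℚ < ε → 0ℚ < B → ∃ λ δ → 0ℚ < δ × B * δ ≡ ε
split {ε} {B} 0<ε 0<B = δ , positive⁻¹ δ {{δ-pos}} , (begin
    B * (ε * B⁻¹)  ≡⟨ +-*-Solver.solve 3 (λ b e i → b :* (e :* i) := e :* (b :* i))
                        refl B ε B⁻¹ ⟩
    ε * (B * B⁻¹)  ≡⟨ cong (ε *_) (*-inverseʳ B {{B≢0}}) ⟩
    ε * 1ℚ         ≡⟨ *-identityʳ ε ⟩
    ε              ∎)
  where
  open Relation.Binary.PropositionalEquality.≡-Reasoning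
  open +-*-Solver using (_:*_; _:=_)
  B-pos = positive 0<B
  B≢0   = pos⇒nonZero B {{B-pos}}
  B⁻¹   = (1/ B) {{B≢0}}
  δ     = ε * B⁻¹
  δ-pos = pos*pos⇒pos ε {{positive 0<ε}} B⁻¹ {{1/pos⇒pos B {{B-pos}}}}

+-close : ∀ a b c d {δ} → ∣ a - c ∣ < δ → ∣ b - d ∣ < δ →
          ∣ (a + b) - (c + d) ∣ < (1ℚ + 1ℚ) * δ
+-close a b c d {δ} p q = begin-strict
    ∣ (a + b) - (c + d) ∣    ≡⟨ cong ∣_∣ (+-*-Solver.solve 4
                                  (λ a b c d → (a :+ b) :- (c :+ d) := (a :- c) :+ (b :- d))
                                  refl a b c d) ⟩
    ∣ (a - c) + (b - d) ∣    ≤⟨ ∣p+q∣≤∣p∣+∣q∣ (a - c) (b - d) ⟩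
    ∣ a - c ∣ + ∣ b - d ∣    <⟨ +-mono-< p q ⟩
    δ + δ                    ≡⟨ cong₂ _+_ (*-identityˡ δ) (*-identityˡ δ) ⟨
    1ℚ * δ + 1ℚ * δ          ≡⟨ *-distribʳ-+ δ 1ℚ 1ℚ ⟨
    (1ℚ + 1ℚ) * δ            ∎
  where
  open ≤-Reasoning
  open +-*-Solver using (_:+_; _:-_; _:=_)

-‿close : ∀ a c {δ} → ∣ a - c ∣ < δ → ∣ (- a) - (- c) ∣ < δ
-‿close a c {δ} = subst (_< δ) (begin
    ∣ a - c ∣          ≡⟨ ∣-p∣≡∣p∣ (a - c) ⟨
    ∣ - (a - c) ∣      ≡⟨ cong ∣_∣ (neg-distrib-+ a (- c)) ⟩
    ∣ (- a) - (- c) ∣  ∎)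
  where open Relation.Binary.PropositionalEquality.≡-Reasoning

*-close : ∀ a b c d {B C δ} → 0ℚ < B → 0ℚ < C → ∣ a ∣ ≤ B → ∣ d ∣ ≤ C →
          ∣ a - c ∣ < δ → ∣ b - d ∣ < δ → ∣ a * b - c * d ∣ < (B + C) * δ
*-close a b c d {B} {C} {δ} 0<B 0<C ∣a∣≤B ∣d∣≤C p q = begin-strict
    ∣ a * b - c * d ∣                      ≡⟨ cong ∣_∣ (+-*-Solver.solve 4
                                                (λ a b c d → a :* b :- c :* d
                                                          := a :* (b :- d) :+ d :* (a :- c))
                                                refl a b c d) ⟩
    ∣ a * (b - d) + d * (a - c) ∣          ≤⟨ ∣p+q∣≤∣p∣+∣q∣ (a * (b - d)) (d * (a - c)) ⟩
    ∣ a * (b - d) ∣ + ∣ d * (a - c) ∣      ≡⟨ cong₂ _+_ (∣p*q∣≡∣p∣*∣q∣ a (b - d))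
                                                       (∣p*q∣≡∣p∣*∣q∣ d (a - c)) ⟩
    ∣ a ∣ * ∣ b - d ∣ + ∣ d ∣ * ∣ a - c ∣  <⟨ +-mono-< (bound 0<B ∣a∣≤B q) (bound 0<C ∣d∣≤C p) ⟩
    B * δ + C * δ                          ≡⟨ *-distribʳ-+ δ B C ⟨
    (B + C) * δ                            ∎
  where
  open ≤-Reasoning
  open +-*-Solver using (_:+_; _:*_; _:-_; _:=_)

  bound : ∀ {r s D} → 0ℚ < D → ∣ r ∣ ≤ D → ∣ s ∣ < δ → ∣ r ∣ * ∣ s ∣ < D * δ
  bound {r} {s} {D} 0<D r≤D s<δ = begin-strict
    ∣ r ∣ * ∣ s ∣  ≤⟨ *-monoʳ-≤-nonNeg ∣ s ∣ {{∣-∣-nonNeg s}} r≤D ⟩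
    D * ∣ s ∣      <⟨ *-monoʳ-<-pos D {{positive 0<D}} s<δ ⟩
    D * δ          ∎

bounded : ∀ x → ∃ λ B → 0ℚ < B × ∃ λ N → ∀ n → N ℕ.≤ n → ∣ seq x n ∣ ≤ B
bounded x =
  let N , close = cauchy x 1ℚ (positive⁻¹ 1ℚ)
  in  1ℚ + ∣ seq x N ∣ , +-mono-<-≤ (positive⁻¹ 1ℚ) (0≤∣p∣ (seq x N)) ,
      N , λ n N≤n → step (seq x n) (seq x N) (close n N N≤n ℕ.≤-refl)
  where
  open ≤-Reasoning
  open +-*-Solver using (_:+_; _:-_; _:=_)

  step : ∀ a b → ∣ a - b ∣ < 1ℚ → ∣ a ∣ ≤ 1ℚ + ∣ b ∣
  step a b p = begin
    ∣ a ∣              ≡⟨ cong ∣_∣ (+-*-Solver.solve 2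
                            (λ a b → a := (a :- b) :+ b) refl a b) ⟩
    ∣ (a - b) + b ∣    ≤⟨ ∣p+q∣≤∣p∣+∣q∣ (a - b) b ⟩
    ∣ a - b ∣ + ∣ b ∣  ≤⟨ +-monoˡ-≤ ∣ b ∣ (<⇒≤ p) ⟩
    1ℚ + ∣ b ∣         ∎

infixl 6 _+ℝ_ _-ℝ_
infixl 7 _*ℝ_
infix  8 -ℝ_

_+ℝ_ : ℝ → ℝ → ℝ
x +ℝ y = mkℝ (λ n → seq x n + seq y n) λ ε 0<ε →
  let δ , 0<δ , eq = split 0<ε (positive⁻¹ (1ℚ + 1ℚ))
      N , p = cauchy x δ 0<δ
      M , q = cauchy y δ 0<δ
  in N ℕ.⊔ M , λ m n m≥ n≥ → <-respʳ-≡ eq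
    (+-close (seq x m) (seq y m) (seq x n) (seq y n)
      (p m n (ℕ.m⊔n≤o⇒m≤o N M m≥) (ℕ.m⊔n≤o⇒m≤o N M n≥))
      (q m n (ℕ.m⊔n≤o⇒n≤o N M m≥) (ℕ.m⊔n≤o⇒n≤o N M n≥)))

-ℝ_ : ℝ → ℝ
-ℝ x = mkℝ (λ n → - seq x n) λ ε 0<ε →
  let N , p = cauchy x ε 0<ε
  in N , λ m n m≥ n≥ → -‿close (seq x m) (seq x n) (p m n m≥ n≥)

_-ℝ_ : ℝ → ℝ → ℝ
x -ℝ y = x +ℝ (-ℝ y)

_*ℝ_ : ℝ → ℝ → ℝ
x *ℝ y = mkℝ (λ n → seq x n * seq y n) λ ε 0<ε →
  let B , 0<B , K , x≤B = bounded x
      C , 0<C , L , y≤C = bounded y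
      δ , 0<δ , eq = split 0<ε (+-mono-< 0<B 0<C)
      N , p = cauchy x δ 0<δ
      M , q = cauchy y δ 0<δ
  in (K ℕ.⊔ L) ℕ.⊔ (N ℕ.⊔ M) , λ m n m≥ n≥ →
    let KLm = ℕ.m⊔n≤o⇒m≤o (K ℕ.⊔ L) (N ℕ.⊔ M) m≥
        KLn = ℕ.m⊔n≤o⇒m≤o (K ℕ.⊔ L) (N ℕ.⊔ M) n≥
        NMm = ℕ.m⊔n≤o⇒n≤o (K ℕ.⊔ L) (N ℕ.⊔ M) m≥
        NMn = ℕ.m⊔n≤o⇒n≤o (K ℕ.⊔ L) (N ℕ.⊔ M) n≥
    in <-respʳ-≡ eq
         (*-close (seq x m) (seq y m) (seq x n) (seq y n) 0<B 0<C
           (x≤B m (ℕ.m⊔n≤o⇒m≤o K L KLm)) (y≤C n (ℕ.m⊔n≤o⇒n≤o K L KLn))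
           (p m n (ℕ.m⊔n≤o⇒m≤o N M NMm) (ℕ.m⊔n≤o⇒m≤o N M NMn))
           (q m n (ℕ.m⊔n≤o⇒n≤o N M NMm) (ℕ.m⊔n≤o⇒n≤o N M NMn)))

------------------------------------------------------------------------
-- `Term n` is T[x₁,…,xₙ]; the variable xᵢ₊₁ is `var i`.

infixr 7 _⊓ₜ_
infixr 6 _⊔ₜ_

data Term (n : ℕ) : Set where
  0ₜ 1ₜ     : Term n
  var       : Fin n → Term n
  ¬ₜ_       : Term n → Term n
  _⊔ₜ_ _⊓ₜ_ : Term n → Term n → Term n

------------------------------------------------------------------------

record FinitaryProbabilitySpace (c ℓ : Level) : Set (suc (c ⊔ ℓ)) where
  field
    booleanAlgebra : BooleanAlgebra c ℓ

  open BooleanAlgebra booleanAlgebra public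
    using (_≈_; _∨_; _∧_; ⊤; ⊥)
    renaming (Carrier to Event; ¬_ to _ᶜ)

  field
    ⊥≉⊤     : ¬ (⊥ ≈ ⊤)
    Pr      : Event → ℝ
    -- Events form a setoid, so Pr being a map includes respecting _≈_.
    Pr-cong : ∀ {a b} → a ≈ b → Pr a ≈ℝ Pr b
    0≤Pr    : ∀ a → 0ℝ ≤ℝ Pr a
    Pr≤1    : ∀ a → Pr a ≤ℝ 1ℝ
    Pr-⊥    : Pr ⊥ ≈ℝ 0ℝ
    Pr-⊤    : Pr ⊤ ≈ℝ 1ℝ
    Pr-∨    : ∀ a b → Pr (a ∨ b) ≈ℝ (Pr a +ℝ Pr b) -ℝ Pr (a ∧ b)

  Φ : ∀ {n} → Term n → Vector Event n → Event
  Φ 0ₜ       b = ⊥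
  Φ 1ₜ       b = ⊤
  Φ (var i)  b = b i
  Φ (¬ₜ t)   b = (Φ t b) ᶜ
  Φ (t ⊔ₜ u)  b = Φ t b ∨ Φ u b
  Φ (t ⊓ₜ u)  b = Φ t b ∧ Φ u b

  ⋀[_]_ : ∀ {m} → Subset m → Vector Event m → Event
  ⋀[ [] ]          a = ⊤
  ⋀[ inside  ∷ X ] a = head a ∧ (⋀[ X ] tail a)
  ⋀[ outside ∷ X ] a = ⋀[ X ] tail a

  Independent : ∀ {m k} → Vector Event m → Vector Event k → Set
  Independent {m} {k} a b = (X : Subset m) (Y : Subset k) →
    Pr ((⋀[ X ] a) ∧ (⋀[ Y ] b)) ≈ℝ Pr (⋀[ X ] a) *ℝ Pr (⋀[ Y ] b)

{-# OPTIONS --safe #-}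

-- Fix an event y.  The events independent of y contain e ∧ xᶜ as soon as they
-- contain e and e ∧ x, but they need not be closed under meets.  Passing to
-- those e for which every e ∧ ⋀[ X ] a is independent of y repairs this: the x
-- that preserve this smaller class under meets include the aᵢ and are closed
-- under all Boolean operations, hence include every Φ t a.  Applying this to
-- the first tuple, with y a meet of the second, and then to the second tuple,
-- with y = Φ t (take n a), gives the theorem.

module Submission where

open import Defs
open import Algebra.Bundles using (CommutativeSemiring)
open import Algebra.Lattice.Bundles using (BooleanAlgebra)
import Algebra.Lattice.Properties.BooleanAlgebra as BooleanAlgebraProperties
import Algebra.Properties.CommutativeSemigroup as CommutativeSemigroupProperties
open import Data.Fin.Base using (zero; suc)
open import Data.Fin.Subset using (Subset; inside; outside)
  renaming (⊥ to ∅)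
open import Data.Nat.Base using (ℕ; _+_; NonZero)
import Data.Nat.Base as ℕ
import Data.Nat.Properties as ℕ
open import Data.Product using (_,_)
open import Data.Rational as ℚ using (0ℚ; 1ℚ; _<_; ∣_∣)
import Data.Rational.Properties as ℚ
open import Data.Rational.Solver using (module +-*-Solver)
open import Data.Vec.Base using (_∷_; _[_]≔_)
open import Data.Vec.Functional using (Vector; tail; take; drop)
open import Relation.Binary.Bundles using (Setoid)
open import Relation.Binary.PropositionalEquality
  using (_≡_; refl; sym; trans; cong; subst)
import Relation.Binary.Reasoning.Setoid as SetoidReasoning

open +-*-Solver using (solve; _:+_; _:*_; _:-_; _:=_; :-_; con)

-- Equality of reals is an equivalence compatible with the arithmetic.

≗⇒≈ℝ : ∀ {x y} → (∀ n → seq x n ≡ seq y n) → x ≈ℝ y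
≗⇒≈ℝ {x} {y} x≗y ε 0<ε = 0 , λ n _ → subst (λ r → ∣ r ∣ < ε)
  (sym (trans (cong (ℚ._- seq y n) (x≗y n)) (ℚ.+-inverseʳ (seq y n)))) 0<ε

≈ℝ-sym : ∀ {x y} → x ≈ℝ y → y ≈ℝ x
≈ℝ-sym {x} {y} x≈y ε 0<ε =
  let N , p = x≈y ε 0<ε
  in N , λ n n≥ → subst (_< ε) (∣p-q∣≡∣q-p∣ (seq x n) (seq y n)) (p n n≥)
  where
  ∣p-q∣≡∣q-p∣ : ∀ p q → ∣ p ℚ.- q ∣ ≡ ∣ q ℚ.- p ∣
  ∣p-q∣≡∣q-p∣ p q = trans (sym (ℚ.∣-p∣≡∣p∣ (p ℚ.- q)))
    (cong ∣_∣ (solve 2 (λ p q → :- (p :- q) := q :- p) refl p q))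

≈ℝ-trans : ∀ {x y z} → x ≈ℝ y → y ≈ℝ z → x ≈ℝ z
≈ℝ-trans {x} {y} {z} x≈y y≈z ε 0<ε =
  let δ , 0<δ , eq = split 0<ε (ℚ.positive⁻¹ (1ℚ ℚ.+ 1ℚ))
      N , p = x≈y δ 0<δ
      M , q = y≈z δ 0<δ
  -- The triangle inequality is read off from `+-close`: in `(a + b) - (b + c)` the middle term
  -- cancels.
  in N ℕ.⊔ M , λ n n≥ → subst (∣ seq x n ℚ.- seq z n ∣ <_) eq
       (subst (λ r → ∣ r ∣ < _)
         (solve 3 (λ a b c → (a :+ b) :- (b :+ c) := a :- c) refl
           (seq x n) (seq y n) (seq z n))
         (+-close (seq x n) (seq y n) (seq y n) (seq z n)
           (p n (ℕ.m⊔n≤o⇒m≤o N M n≥)) (q n (ℕ.m⊔n≤o⇒n≤o N M n≥))))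

ℝ-setoid : Setoid _ _
ℝ-setoid = record
  { Carrier       = ℝ
  ; _≈_           = _≈ℝ_
  ; isEquivalence = record
    -- Here and below the reals are passed explicitly: `_≈ℝ_` unfolds to a statement about `seq`
    -- alone, which leaves the `cauchy` fields undetermined.
    { refl  = λ {x} → ≗⇒≈ℝ {x} {x} (λ _ → refl)
    ; sym   = λ {x} {y} → ≈ℝ-sym {x} {y}
    ; trans = λ {x} {y} {z} → ≈ℝ-trans {x} {y} {z}
    }
  }

private module ≈ℝ = Setoid ℝ-setoid

+ℝ-cong : ∀ {x x′ y y′} → x ≈ℝ x′ → y ≈ℝ y′ → x +ℝ y ≈ℝ x′ +ℝ y′
+ℝ-cong {x} {x′} {y} {y′} x≈x′ y≈y′ ε 0<ε =
  let δ , 0<δ , eq = split 0<ε (ℚ.positive⁻¹ (1ℚ ℚ.+ 1ℚ))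
      N , p = x≈x′ δ 0<δ
      M , q = y≈y′ δ 0<δ
  in N ℕ.⊔ M , λ n n≥ → ℚ.<-respʳ-≡ eq
       (+-close (seq x n) (seq y n) (seq x′ n) (seq y′ n)
         (p n (ℕ.m⊔n≤o⇒m≤o N M n≥)) (q n (ℕ.m⊔n≤o⇒n≤o N M n≥)))

-ℝ-cong : ∀ {x x′ y y′} → x ≈ℝ x′ → y ≈ℝ y′ → x -ℝ y ≈ℝ x′ -ℝ y′
-ℝ-cong {x} {x′} {y} {y′} x≈x′ y≈y′ =
  +ℝ-cong {x} {x′} { -ℝ y} { -ℝ y′} x≈x′ λ ε 0<ε →
    let N , p = y≈y′ ε 0<ε
    in N , λ n n≥ → -‿close (seq y n) (seq y′ n) (p n n≥)

-ℝ-congˡ : ∀ {x y y′} → y ≈ℝ y′ → x -ℝ y ≈ℝ x -ℝ y′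
-ℝ-congˡ {x} {y} {y′} = -ℝ-cong {x} {x} {y} {y′} (≈ℝ.refl {x})

-ℝ-congʳ : ∀ {x x′ y} → x ≈ℝ x′ → x -ℝ y ≈ℝ x′ -ℝ y
-ℝ-congʳ {x} {x′} {y} x≈x′ = -ℝ-cong {x} {x′} {y} {y} x≈x′ (≈ℝ.refl {y})

*ℝ-cong : ∀ {x x′ y y′} → x ≈ℝ x′ → y ≈ℝ y′ → x *ℝ y ≈ℝ x′ *ℝ y′
*ℝ-cong {x} {x′} {y} {y′} x≈x′ y≈y′ ε 0<ε =
  -- Bounds on `x` and `y′` suffice, since `a * b - c * d` equals `a * (b - d) + d * (a - c)`; `δ`
  -- is chosen so that `(B + C) * δ` is `ε`.
  let B , 0<B , K , x≤B  = bounded x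
      C , 0<C , L , y′≤C = bounded y′
      δ , 0<δ , eq = split 0<ε (ℚ.+-mono-< 0<B 0<C)
      N , p = x≈x′ δ 0<δ
      M , q = y≈y′ δ 0<δ
  in (K ℕ.⊔ L) ℕ.⊔ (N ℕ.⊔ M) , λ n n≥ →
    let KL = ℕ.m⊔n≤o⇒m≤o (K ℕ.⊔ L) (N ℕ.⊔ M) n≥
        NM = ℕ.m⊔n≤o⇒n≤o (K ℕ.⊔ L) (N ℕ.⊔ M) n≥
    in ℚ.<-respʳ-≡ eq
         (*-close (seq x n) (seq y n) (seq x′ n) (seq y′ n) 0<B 0<C
           (x≤B n (ℕ.m⊔n≤o⇒m≤o K L KL)) (y′≤C n (ℕ.m⊔n≤o⇒n≤o K L KL))
           (p n (ℕ.m⊔n≤o⇒m≤o N M NM)) (q n (ℕ.m⊔n≤o⇒n≤o N M NM)))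

*ℝ-congʳ : ∀ {x x′ y} → x ≈ℝ x′ → x *ℝ y ≈ℝ x′ *ℝ y
*ℝ-congʳ {x} {x′} {y} x≈x′ = *ℝ-cong {x} {x′} {y} {y} x≈x′ (≈ℝ.refl {y})

*ℝ-comm : ∀ x y → x *ℝ y ≈ℝ y *ℝ x
*ℝ-comm x y = ≗⇒≈ℝ {x *ℝ y} {y *ℝ x} λ n → ℚ.*-comm (seq x n) (seq y n)

*ℝ-distribʳ--ℝ : ∀ x y z → (y -ℝ z) *ℝ x ≈ℝ y *ℝ x -ℝ z *ℝ x
*ℝ-distribʳ--ℝ x y z = ≗⇒≈ℝ {(y -ℝ z) *ℝ x} {y *ℝ x -ℝ z *ℝ x} λ n →
  solve 3 (λ x y z → (y :- z) :* x := y :* x :- z :* x) refl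
    (seq x n) (seq y n) (seq z n)

-- Complements, independence of two events, and meets over subsets.

module _ {c ℓ} (S : FinitaryProbabilitySpace c ℓ) where
  open FinitaryProbabilitySpace S
  private module BA where
    open BooleanAlgebra booleanAlgebra public
    open BooleanAlgebraProperties booleanAlgebra public
  open CommutativeSemigroupProperties
    (CommutativeSemiring.*-commutativeSemigroup BA.∨-∧-commutativeSemiring)
    using (xy∙z≈xz∙y; x∙yz≈y∙xz)

  -- The events `e ∧ x ᶜ` and `e ∧ x` are disjoint with join `e`, so `Pr-∨` makes their
  -- probabilities add up to that of `e`.
  Pr-∧ᶜ : ∀ e x → Pr (e ∧ x ᶜ) ≈ℝ Pr e -ℝ Pr (e ∧ x)
  Pr-∧ᶜ e x = begin
    -- The inserted zero stands for the probability `r` of the overlap, which brings the expression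
    -- into the shape of `Pr-∨`.
    p                      ≈⟨ ≗⇒≈ℝ {p} {((p +ℝ q) -ℝ 0ℝ) -ℝ q} (λ n →
                                solve 2 (λ p q → p := ((p :+ q) :- con 0ℚ) :- q) refl
                                  (seq p n) (seq q n)) ⟩
    ((p +ℝ q) -ℝ 0ℝ) -ℝ q  ≈⟨ -ℝ-congʳ {(p +ℝ q) -ℝ r} {(p +ℝ q) -ℝ 0ℝ} {q}
                                (-ℝ-congˡ {p +ℝ q} {r} {0ℝ} Pr-meet) ⟨
    ((p +ℝ q) -ℝ r) -ℝ q   ≈⟨ -ℝ-congʳ {Pr ((e ∧ x ᶜ) ∨ (e ∧ x))} {(p +ℝ q) -ℝ r} {q}
                                (Pr-∨ (e ∧ x ᶜ) (e ∧ x)) ⟨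
    Pr ((e ∧ x ᶜ) ∨ (e ∧ x)) -ℝ q
                           ≈⟨ -ℝ-congʳ {Pr ((e ∧ x ᶜ) ∨ (e ∧ x))} {Pr e} {q}
                                (Pr-cong join) ⟩
    Pr e -ℝ q              ∎
    where
    open SetoidReasoning ℝ-setoid
    p = Pr (e ∧ x ᶜ)
    q = Pr (e ∧ x)
    r = Pr ((e ∧ x ᶜ) ∧ (e ∧ x))

    join : (e ∧ x ᶜ) ∨ (e ∧ x) ≈ e
    join = BA.trans (BA.sym (BA.∧-distribˡ-∨ e (x ᶜ) x))
      (BA.trans (BA.∧-congˡ (BA.∨-complementˡ x)) (BA.∧-identityʳ e))

    meet : (e ∧ x ᶜ) ∧ (e ∧ x) ≈ ⊥
    meet = BA.trans (x∙yz≈y∙xz (e ∧ x ᶜ) e x)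
      (BA.trans (BA.∧-congˡ (BA.trans (BA.∧-assoc e (x ᶜ) x)
        (BA.trans (BA.∧-congˡ (BA.∧-complementˡ x)) (BA.∧-zeroʳ e))))
      (BA.∧-zeroʳ e))

    Pr-meet : Pr ((e ∧ x ᶜ) ∧ (e ∧ x)) ≈ℝ 0ℝ
    Pr-meet = ≈ℝ.trans {r} {Pr ⊥} {0ℝ} (Pr-cong meet) Pr-⊥

  infix 4 _⫫_

  _⫫_ : Event → Event → Set
  x ⫫ y = Pr (x ∧ y) ≈ℝ Pr x *ℝ Pr y

  ⫫-sym : ∀ {x y} → x ⫫ y → y ⫫ x
  ⫫-sym {x} {y} x⫫y = begin
    Pr (y ∧ x)    ≈⟨ Pr-cong (BA.∧-comm y x) ⟩
    Pr (x ∧ y)    ≈⟨ x⫫y ⟩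
    Pr x *ℝ Pr y  ≈⟨ *ℝ-comm (Pr x) (Pr y) ⟩
    Pr y *ℝ Pr x  ∎
    where open SetoidReasoning ℝ-setoid

  ⫫-respˡ-≈ : ∀ {x x′ y} → x ≈ x′ → x ⫫ y → x′ ⫫ y
  ⫫-respˡ-≈ {x} {x′} {y} x≈x′ x⫫y = begin
    Pr (x′ ∧ y)    ≈⟨ Pr-cong (BA.∧-congʳ x≈x′) ⟨
    Pr (x ∧ y)     ≈⟨ x⫫y ⟩
    Pr x *ℝ Pr y   ≈⟨ *ℝ-congʳ {Pr x} {Pr x′} {Pr y} (Pr-cong x≈x′) ⟩
    Pr x′ *ℝ Pr y  ∎
    where open SetoidReasoning ℝ-setoid

  -- By `Pr-∧ᶜ`, applied to `e ∧ y` on the left and to `e` on the right, both sides become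
  -- differences; the two hypotheses match them term by term once `Pr y` is factored out.
  ⫫-∧ᶜ : ∀ {e x y} → e ⫫ y → e ∧ x ⫫ y → e ∧ x ᶜ ⫫ y
  ⫫-∧ᶜ {e} {x} {y} e⫫y ex⫫y = begin
    Pr ((e ∧ x ᶜ) ∧ y)                 ≈⟨ Pr-cong (xy∙z≈xz∙y e (x ᶜ) y) ⟩
    Pr ((e ∧ y) ∧ x ᶜ)                 ≈⟨ Pr-∧ᶜ (e ∧ y) x ⟩
    Pr (e ∧ y) -ℝ Pr ((e ∧ y) ∧ x)     ≈⟨ -ℝ-cong {Pr (e ∧ y)} {Pr e *ℝ Pr y}
                                            {Pr ((e ∧ y) ∧ x)} {Pr (e ∧ x) *ℝ Pr y}
                                            e⫫y Pr-eyx ⟩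
    Pr e *ℝ Pr y -ℝ Pr (e ∧ x) *ℝ Pr y ≈⟨ *ℝ-distribʳ--ℝ (Pr y) (Pr e) (Pr (e ∧ x)) ⟨
    (Pr e -ℝ Pr (e ∧ x)) *ℝ Pr y       ≈⟨ *ℝ-congʳ {Pr (e ∧ x ᶜ)} {Pr e -ℝ Pr (e ∧ x)} {Pr y}
                                            (Pr-∧ᶜ e x) ⟨
    Pr (e ∧ x ᶜ) *ℝ Pr y               ∎
    where
    open SetoidReasoning ℝ-setoid

    Pr-eyx : Pr ((e ∧ y) ∧ x) ≈ℝ Pr (e ∧ x) *ℝ Pr y
    Pr-eyx = ≈ℝ.trans {Pr ((e ∧ y) ∧ x)} {Pr ((e ∧ x) ∧ y)} {Pr (e ∧ x) *ℝ Pr y}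
      (Pr-cong (xy∙z≈xz∙y e y x)) ex⫫y

  -- If `i` already lies in `X`, idempotence absorbs the repeated factor. Hence multiplying by an
  -- entry never leaves the family of meets over subsets.
  ⋀-insert : ∀ {m} (X : Subset m) i (a : Vector Event m) →
             ⋀[ X [ i ]≔ inside ] a ≈ a i ∧ (⋀[ X ] a)
  ⋀-insert (inside  ∷ X) zero    a = BA.trans
    (BA.∧-congʳ (BA.sym (BA.∧-idem (a zero)))) (BA.∧-assoc _ _ _)
  ⋀-insert (outside ∷ X) zero    a = BA.refl
  ⋀-insert (inside  ∷ X) (suc i) a = BA.trans
    (BA.∧-congˡ (⋀-insert X i (tail a))) (x∙yz≈y∙xz _ _ _)
  ⋀-insert (outside ∷ X) (suc i) a = ⋀-insert X i (tail a)

  ⋀-∅ : ∀ {m} (a : Vector Event m) → ⋀[ ∅ ] a ≈ ⊤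
  ⋀-∅ {ℕ.zero}  a = BA.refl
  ⋀-∅ {ℕ.suc m} a = ⋀-∅ (tail a)

  -- Events that preserve independence from `y` under meets.

  module _ {m} (a : Vector Event m) (y : Event) where

    -- Up to `_≈_`, the case `e = ⊤` says that all meets of the tuple are independent of `y`, and
    -- the instance `X = ∅` says `e ⫫ y`.
    MeetsIndependent : Event → Set
    MeetsIndependent e = ∀ X → e ∧ (⋀[ X ] a) ⫫ y

    -- Since `e` is arbitrary, closure under `_∧_` is mere composition, with no computation of
    -- probabilities.
    Preserves : Event → Set _
    Preserves x = ∀ {e} → MeetsIndependent e → MeetsIndependent (e ∧ x)

    preserves-resp-≈ : ∀ {x x′} → x ≈ x′ → Preserves x → Preserves x′
    preserves-resp-≈ x≈x′ px pe X =
      ⫫-respˡ-≈ (BA.∧-congʳ (BA.∧-congˡ x≈x′)) (px pe X)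

    preserves-⊤ : Preserves ⊤
    preserves-⊤ pe X = ⫫-respˡ-≈ (BA.∧-congʳ (BA.sym (BA.∧-identityʳ _))) (pe X)

    preserves-∧ : ∀ {x z} → Preserves x → Preserves z → Preserves (x ∧ z)
    preserves-∧ px pz pe X =
      ⫫-respˡ-≈ (BA.∧-congʳ (BA.∧-assoc _ _ _)) (pz (px pe) X)

    -- For each `X` this is `⫫-∧ᶜ` with `e ∧ (⋀[ X ] a)` in the role of `e`, after moving `x` past
    -- the meet; its premises are `pe X` and `px pe X`.
    preserves-ᶜ : ∀ {x} → Preserves x → Preserves (x ᶜ)
    preserves-ᶜ px pe X = ⫫-respˡ-≈ (xy∙z≈xz∙y _ _ _)
      (⫫-∧ᶜ (pe X) (⫫-respˡ-≈ (xy∙z≈xz∙y _ _ _) (px pe X)))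

    preserves-∨ : ∀ {x z} → Preserves x → Preserves z → Preserves (x ∨ z)
    preserves-∨ {x} {z} px pz = preserves-resp-≈
      (BA.trans (BA.¬-cong (BA.sym (BA.deMorgan₂ x z))) (BA.¬-involutive (x ∨ z)))
      (preserves-ᶜ (preserves-∧ (preserves-ᶜ px) (preserves-ᶜ pz)))

    -- The factor `a i` is absorbed into the meet: the claim at `X` is the assumption on `e` at `X`
    -- with `i` inserted, which is why the class quantifies over all `X`.
    preserves-entry : ∀ i → Preserves (a i)
    preserves-entry i pe X = ⫫-respˡ-≈
      (BA.trans (BA.∧-congˡ (⋀-insert X i a)) (BA.sym (BA.∧-assoc _ _ _)))
      (pe (X [ i ]≔ inside))

    preserves-Φ : ∀ t → Preserves (Φ t a)
    preserves-Φ 0ₜ       = preserves-resp-≈ BA.¬⊤≈⊥ (preserves-ᶜ preserves-⊤)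
    preserves-Φ 1ₜ       = preserves-⊤
    preserves-Φ (var i)  = preserves-entry i
    preserves-Φ (¬ₜ t)   = preserves-ᶜ (preserves-Φ t)
    preserves-Φ (t ⊔ₜ u) = preserves-∨ (preserves-Φ t) (preserves-Φ u)
    preserves-Φ (t ⊓ₜ u) = preserves-∧ (preserves-Φ t) (preserves-Φ u)

    Φ-⫫ : (∀ X → ⋀[ X ] a ⫫ y) → ∀ t → Φ t a ⫫ y
    Φ-⫫ a⫫y t = ⫫-respˡ-≈
      (BA.trans (BA.∧-cong (BA.∧-identityˡ _) (⋀-∅ a)) (BA.∧-identityʳ _))
      -- Start from `e = ⊤`, which lies in the class by `a⫫y`, and evaluate the result at the empty
      -- subset.
      (preserves-Φ t (λ X → ⫫-respˡ-≈ (BA.sym (BA.∧-identityˡ _)) (a⫫y X)) ∅)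

theorem8p5 : ∀ {c ℓ} (S : FinitaryProbabilitySpace c ℓ) →
    let open FinitaryProbabilitySpace S in
    (n : ℕ) .{{_ : NonZero n}} (t u : Term n) (a : Vector Event (n + n)) →
    Independent (take n a) (drop n a) →
    Pr (Φ t (take n a) ∧ Φ u (drop n a)) ≈ℝ
    Pr (Φ t (take n a)) *ℝ Pr (Φ u (drop n a))
theorem8p5 S n t u a ind =
  -- `Φ-⫫` replaces only the left event, so symmetry exchanges the sides between the two
  -- applications and restores the order at the end.
  ⫫-sym S (Φ-⫫ S (drop n a) (Φ t (take n a))
    (λ Y → ⫫-sym S (Φ-⫫ S (take n a) (⋀[ Y ] drop n a) (λ X → ind X Y) t)) u)
  where open FinitaryProbabilitySpace S
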